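{- Let $R\ge1$ be an integer and suppose every ball of radius $R$ in the graph $G$ contains at most one cycle. Then for every subgraph $S\subseteq G$ with $s$ edges, every directed edge of $S$, and every $t\ge1$, the number of non-backtracking paths of length $t$ in $S$ from that edge is at most $$\bigl(2s(R+3)\bigr)^{\lceil t/R\rceil};$$ in particular the exponential growth rate (in $t$) of this number is at most $\exp\bigl(O(\log(sR)/R)\bigr)$.
   Context: $G$ is a finite simple graph. The ball of radius $R$ around a vertex $v$ is the subgraph induced on the vertices at distance at most $R$ from $v$. A non-backtracking path of length $t$ in $S$ from a directed edge $e_0$ is a sequence of directed edges $(e_0,e_1,\dots,e_t)$ of $S$ such that the head of $e_{i}$ is the tail of $e_{i+1}$ and $e_{i+1}\ne\bar e_i$ ($\bar e$ the reversal of $e$) for $0\le i<t$; vertices and edges may repeat. -}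

module Defs where

open import Data.Nat.Base using (ℕ; zero; suc; pred; _+_; _*_; _^_; _≤_; _<_; NonZero)
open import Data.Nat.DivMod using (_/_)
open import Data.Fin.Base using (Fin)
import Data.Fin.Base as Fin
import Data.Fin.Properties as Fin
open import Data.List.Base using
  (List; []; _∷_; _++_; [_]; length; filter; allFin; cartesianProduct; cartesianProductWith)
open import Data.List.Relation.Unary.Linked using (Linked)
open import Data.List.Relation.Unary.Unique.Propositional using (Unique)
open import Data.Product.Base using (_×_; _,_; ∃; ∃₂; proj₁; proj₂; swap; uncurry)
open import Data.Product.Properties using (≡-dec)
open import Data.Sum.Base using (_⊎_)
open import Data.Vec.Base using (Vec; head)
import Data.Vec.Base as Vec
import Data.Vec.Relation.Unary.All as VecAll
import Data.Vec.Relation.Unary.Linked as VecLinked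
open import Function.Bundles using (_⇔_)
open import Level using (0ℓ)
open import Relation.Binary.Core using (Rel)
open import Relation.Binary.Definitions using (Symmetric; Irreflexive; Decidable; DecidableEquality)
open import Relation.Binary.PropositionalEquality.Core using (_≡_; _≢_)
open import Relation.Nullary.Decidable using (Dec; _×-dec_; ¬?)
open import Relation.Unary using (Pred)

record Graph (n : ℕ) : Set₁ where
  field
    Adj    : Rel (Fin n) 0ℓ
    adj?   : Decidable Adj
    sym    : Symmetric Adj
    irrefl : Irreflexive _≡_ Adj

open Graph public using (Adj)

-- Decidability is not part of the structure, so that balls are subgraphs by
-- definition; where edges have to be counted it is a separate argument.
record Subgraph {n : ℕ} (G : Graph n) : Set₁ where
  field
    Vertex      : Pred (Fin n) 0ℓ
    Edge        : Rel (Fin n) 0ℓ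
    edge-sym    : Symmetric Edge
    edge⇒adj    : ∀ {u v} → Edge u v → Adj G u v
    edge⇒vertex : ∀ {u v} → Edge u v → Vertex u

open Subgraph public using (Vertex; Edge)

induced : ∀ {n} (G : Graph n) → Pred (Fin n) 0ℓ → Subgraph G
induced G P = record
  { Vertex      = P
  ; Edge        = λ u v → Adj G u v × P u × P v
  ; edge-sym    = λ (a , pu , pv) → Graph.sym G a , pv , pu
  ; edge⇒adj    = proj₁
  ; edge⇒vertex = λ (_ , pu , _) → pu
  }

data Walk {n : ℕ} (G : Graph n) : ℕ → Rel (Fin n) 0ℓ where
  nil  : ∀ {u} → Walk G zero u u
  cons : ∀ {ℓ u v w} → Adj G u v → Walk G ℓ v w → Walk G (suc ℓ) u w

Distance : ∀ {n} → Graph n → Fin n → Fin n → ℕ → Set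
Distance G u v d = Walk G d u v × (∀ ℓ → Walk G ℓ u v → d ≤ ℓ)

ball : ∀ {n} (G : Graph n) → ℕ → Fin n → Subgraph G
ball G R v = induced G (λ w → ∃ λ d → Distance G v w d × d ≤ R)

-- A cycle is presented by a cyclic listing of its (at least three, distinct)
-- vertices from some starting point in one of its two orientations.
record Cycle {n : ℕ} {G : Graph n} (H : Subgraph G) : Set where
  field
    base : Fin n
    rest : List (Fin n)

  closedWalk : List (Fin n)
  closedWalk = base ∷ rest ++ [ base ]

  field
    long   : 2 ≤ length rest
    simple : Unique (base ∷ rest)
    edges  : Linked (Edge H) closedWalk

module _ {n : ℕ} {G : Graph n} {H : Subgraph G} where

  Traverses : Cycle H → Rel (Fin n) 0ℓ
  Traverses c u v = ∃₂ λ xs ys → Cycle.closedWalk c ≡ xs ++ u ∷ v ∷ ys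

  CycleEdge : Cycle H → Rel (Fin n) 0ℓ
  CycleEdge c u v = Traverses c u v ⊎ Traverses c v u

  -- Equality of cycles as subgraphs; the edges determine the vertices.
  SameCycle : Rel (Cycle H) 0ℓ
  SameCycle c d = ∀ u v → CycleEdge c u v ⇔ CycleEdge d u v

AtMostOneCycle : ∀ {n} {G : Graph n} → Subgraph G → Set
AtMostOneCycle H = (c d : Cycle H) → SameCycle c d

-- (u , v) stands for the directed edge with tail u and head v.
Arc : ℕ → Set
Arc n = Fin n × Fin n

allArcs : ∀ n → List (Arc n)
allArcs n = cartesianProduct (allFin n) (allFin n)

allVecs : ∀ {A : Set} → List A → (m : ℕ) → List (Vec A m)
allVecs xs zero    = [ Vec.[] ]
allVecs xs (suc m) = cartesianProductWith Vec._∷_ xs (allVecs xs m)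

_≟ᵃ_ : ∀ {n} → DecidableEquality (Arc n)
_≟ᵃ_ = ≡-dec Fin._≟_ Fin._≟_

Follows : ∀ {n} → Rel (Arc n) 0ℓ
Follows e f = proj₂ e ≡ proj₁ f × f ≢ swap e

follows? : ∀ {n} → Decidable (Follows {n})
follows? e f = (proj₂ e Fin.≟ proj₁ f) ×-dec ¬? (f ≟ᵃ swap e)

module _ {n : ℕ} {G : Graph n} (S : Subgraph G) where

  ArcOf : Pred (Arc n) 0ℓ
  ArcOf = uncurry (Edge S)

  IsNonBacktrackingPath : ∀ {t} → Arc n → Vec (Arc n) (suc t) → Set
  IsNonBacktrackingPath e₀ es =
    head es ≡ e₀ × VecAll.All ArcOf es × VecLinked.Linked Follows es

  module _ (edge? : Decidable (Edge S)) where

    arcOf? : ∀ e → Dec (ArcOf e)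
    arcOf? (u , v) = edge? u v

    isNonBacktrackingPath? : ∀ {t} e₀ (es : Vec (Arc n) (suc t)) →
                             Dec (IsNonBacktrackingPath e₀ es)
    isNonBacktrackingPath? e₀ es =
      (head es ≟ᵃ e₀) ×-dec VecAll.all? arcOf? es ×-dec VecLinked.linked? follows? es

    -- Each undirected edge {u, v} is counted once, as the pair with u < v.
    edgeCount : ℕ
    edgeCount = length (filter (λ (u , v) → (u Fin.<? v) ×-dec edge? u v) (allArcs n))

    pathCount : Arc n → ℕ → ℕ
    pathCount e₀ t =
      length (filter (isNonBacktrackingPath? e₀) (allVecs (allArcs n) (suc t)))

⌈_/_⌉ : ℕ → (r : ℕ) → .{{_ : NonZero r}} → ℕ
⌈ t / r ⌉ = (t + pred r) / r

-- limsup N(t)^(1/t) ≤ exp (C · log m / R) = (m ^ C)^(1/R), expressed through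
-- rationals: every p / q exceeding the right-hand side, i.e. with
-- (p / q)^R > m ^ C, satisfies N(t) ≤ (p / q)^t for all large t.
GrowthRate≤exp[_·log_/_] : (C m R : ℕ) → (ℕ → ℕ) → Set
GrowthRate≤exp[ C ·log m / R ] N =
  ∀ p q → .{{NonZero q}} → m ^ C * q ^ R < p ^ R →
  ∃ λ T → ∀ t → T ≤ t → N t * q ^ t ≤ p ^ t

{-# OPTIONS --safe #-}

-- A non-backtracking walk of length at most R from an arc stays in the ball of
-- radius R around its head, hence in a forest plus at most one edge ε. Such walks
-- of a given length and given last arc are determined by which orientations of ε
-- they contain: in a forest, non-backtracking walks are determined by their ends,
-- and with ε added a walk can pass ε in one orientation only, while two walks that
-- separate after a passage through ε and of which only one passes it again reach
-- the same end at different lengths. So there are at most 4 · 2s ≤ 2s (R + 3)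
-- walks per block of R steps. For the growth rate, 2s (R + 3) ≤ (s R)^4 unless
-- s R = 1, when a walk on the single edge cannot continue without backtracking.

module Submission where

open import Defs
open import Data.Bool.Base using (Bool; true; false)
import Data.Bool.Properties as Bool
open import Data.Fin.Base as Fin using (Fin)
import Data.Fin.Properties as Fin
open import Data.List.Base using
  (List; []; _∷_; _++_; [_]; length; map; filter; take; drop; deduplicate; allFin; cartesianProduct)
import Data.List.Properties as List
import Data.List.Membership.DecPropositional as DecMembership
open import Data.List.Membership.Propositional using (_∈_; _∉_; find; lose)
open import Data.List.Membership.Propositional.Properties using
  (∈-∃++; ∈-++⁺ˡ; ∈-++⁺ʳ; ∈-++⁻; ∈-map⁺; ∈-filter⁺; ∈-deduplicate⁺; ∈-cartesianProduct⁺; ∈-allFin)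
open import Data.List.Relation.Unary.All as All using (All; []; _∷_)
import Data.List.Relation.Unary.All.Properties as All
open import Data.List.Relation.Unary.AllPairs using ([]; _∷_)
open import Data.List.Relation.Unary.Any as Any using (Any; here; there)
open import Data.List.Relation.Unary.Linked as Linked using (Linked; []; [-]; _∷_)
open import Data.List.Relation.Unary.Unique.Propositional using (Unique)
import Data.List.Relation.Unary.Unique.Propositional.Properties as Unique
import Data.List.Relation.Unary.Unique.DecPropositional.Properties as DecUnique
open import Data.Nat.Base using
  (ℕ; zero; suc; z≤n; s≤s; NonZero; >-nonZero; >-nonZero⁻¹; _+_; _*_; _^_; _∸_; _⊓_; _≤_; _<_)
open import Data.Nat.DivMod using (_/_; _%_; m≡m%n+[m/n]*n; m%n≤n; m%n<n; /-monoˡ-≤; m*n/n≡m)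
open import Data.Nat.Induction using (<-rec)
import Data.Nat.Properties as ℕ
open import Data.Product.Base using (_×_; _,_; ∃; ∃₂; proj₁; proj₂; swap)
import Data.Product.Properties as Product
open import Data.Sum.Base using (_⊎_; inj₁; inj₂)
open import Data.Vec.Base as Vec using (Vec; []; _∷_)
import Data.Vec.Properties as Vec
import Data.Vec.Relation.Unary.All.Properties as VecAll
import Data.Vec.Relation.Unary.Linked as VecLinked
open import Function.Base using (_∘_; id; case_of_)
open import Function.Bundles using (Equivalence)
open import Level using (0ℓ)
open import Relation.Binary.Core using (Rel)
open import Relation.Binary.Definitions using (Decidable; DecidableEquality)
open import Relation.Binary.PropositionalEquality.Core using
  (_≡_; _≢_; refl; sym; trans; cong; cong₂; subst; subst₂; ≢-sym)
open import Relation.Nullary using (¬_; Dec; does; yes; no; contradiction; ¬?)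
open import Relation.Nullary.Decidable using
  (_⊎-dec_; _×-dec_; decidable-stable; map′; ¬¬-excluded-middle)
open import Relation.Unary using (Pred)
import Relation.Unary as Unary

-- Segments of linked and of duplicate-free lists.

module _ {a ℓ} {A : Set a} {R : Rel A ℓ} where

  Linked-++⁻ˡ : ∀ xs {ys} → Linked R (xs ++ ys) → Linked R xs
  Linked-++⁻ˡ []           _        = []
  Linked-++⁻ˡ (x ∷ [])     _        = [-]
  Linked-++⁻ˡ (x ∷ y ∷ xs) (r ∷ rs) = r ∷ Linked-++⁻ˡ (y ∷ xs) rs

  Linked-++⁻ʳ : ∀ xs {ys} → Linked R (xs ++ ys) → Linked R ys
  Linked-++⁻ʳ []       rs = rs
  Linked-++⁻ʳ (x ∷ xs) rs = Linked-++⁻ʳ xs (Linked.tail rs)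

Unique-++-∷⁻ : ∀ {a} {A : Set a} ys {x : A} {zs} → Unique (ys ++ x ∷ zs) → Unique (x ∷ ys)
Unique-++-∷⁻ []       _        = [] ∷ []
Unique-++-∷⁻ (y ∷ ys) (y≢ ∷ u)
  with x≢ ∷ u′ ← Unique-++-∷⁻ ys u | y≢x ∷ _ ← All.++⁻ʳ ys y≢ =
  (≢-sym y≢x ∷ x≢) ∷ All.++⁻ˡ ys y≢ ∷ u′

-- Lists of arcs: reversal, endpoints, visited vertices.

module _ {n : ℕ} where

  infixr 5 _⟲_

  -- The walk back along the first list and then out along the second, for two walks that leave the
  -- same vertex.
  _⟲_ : List (Arc n) → List (Arc n) → List (Arc n)
  []       ⟲ ys = ys
  (x ∷ xs) ⟲ ys = xs ⟲ (swap x ∷ ys)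

  -- The vertex argument is a default: it is the place where the empty walk stands.
  source target : Fin n → List (Arc n) → Fin n
  source u []      = u
  source u (e ∷ _) = proj₁ e
  target u []      = u
  target u (e ∷ W) = target (proj₂ e) W

  source-⟲ : ∀ {u} xs {ys} → source u (xs ⟲ ys) ≡ target (source u ys) xs
  source-⟲ []       = refl
  source-⟲ (x ∷ xs) = source-⟲ xs

  target-⟲ : ∀ {u} xs {y ys} → target u (xs ⟲ (y ∷ ys)) ≡ target u (y ∷ ys)
  target-⟲ []       = refl
  target-⟲ (x ∷ xs) = target-⟲ xs

  target-++ : ∀ {u} xs {ys} → target u (xs ++ ys) ≡ target (target u xs) ys
  target-++ []       = refl
  target-++ (x ∷ xs) = target-++ xs

  ∈-⟲⁺ˡ : ∀ {e} xs {ys} → e ∈ xs → swap e ∈ xs ⟲ ys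
  ∈-⟲⁺ʳ : ∀ {e} xs {ys} → e ∈ ys → e ∈ xs ⟲ ys
  ∈-⟲⁺ˡ (x ∷ xs) (here refl) = ∈-⟲⁺ʳ xs (here refl)
  ∈-⟲⁺ˡ (x ∷ xs) (there i)   = ∈-⟲⁺ˡ xs i
  ∈-⟲⁺ʳ []       i = i
  ∈-⟲⁺ʳ (x ∷ xs) i = ∈-⟲⁺ʳ xs (there i)

  vertices : List (Arc n) → List (Fin n)
  vertices []      = []
  vertices (e ∷ W) = proj₁ e ∷ map proj₂ (e ∷ W)

  target∈heads : ∀ {u} e W → target u (e ∷ W) ∈ map proj₂ (e ∷ W)
  target∈heads e []      = here refl
  target∈heads e (f ∷ W) = there (target∈heads {u = proj₂ e} f W)

  Linked⇒source : ∀ {e W} → Linked Follows (e ∷ W) → source (proj₂ e) W ≡ proj₂ e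
  Linked⇒source {W = []}    _             = refl
  Linked⇒source {W = _ ∷ _} ((p , _) ∷ _) = sym p

  Linked⇒target : ∀ {e} Z {g Y} →
                    Linked Follows (e ∷ Z ++ g ∷ Y) → target (proj₂ e) Z ≡ proj₁ g
  Linked⇒target []      ((p , _) ∷ _) = p
  Linked⇒target (f ∷ Z) (_ ∷ l)       = Linked⇒target Z l

-- Non-backtracking walks in a forest.

module _ {n : ℕ} {G : Graph n} where

  record Trail (H : Subgraph G) (W : List (Arc n)) : Set where
    constructor _,_
    field
      linked : Linked Follows W
      arcs   : All (ArcOf H) W

  open Trail public

  module _ {H : Subgraph G} where

    Trail-++⁻ˡ : ∀ xs {ys} → Trail H (xs ++ ys) → Trail H xs
    Trail-++⁻ˡ xs (l , a) = Linked-++⁻ˡ xs l , All.++⁻ˡ xs a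

    Trail-++⁻ʳ : ∀ xs {ys} → Trail H (xs ++ ys) → Trail H ys
    Trail-++⁻ʳ xs (l , a) = Linked-++⁻ʳ xs l , All.++⁻ʳ xs a

    arc-irrefl : ∀ {u} → ¬ Edge H u u
    arc-irrefl = Graph.irrefl G refl ∘ Subgraph.edge⇒adj H

    Follows-swap : ∀ {e f : Arc n} → Follows e f → Follows (swap f) (swap e)
    Follows-swap (p , q) = sym p , λ r → q (sym r)

    -- At the junction `swap x` is followed by `y`, which backtracks only if `x ≡ y`; elsewhere
    -- reversal preserves `Follows`.
    Trail-⟲ : ∀ {x xs y ys} → Trail H (x ∷ xs) → Trail H (y ∷ ys) →
              proj₁ x ≡ proj₁ y → x ≢ y → Trail H ((x ∷ xs) ⟲ (y ∷ ys))
    Trail-⟲ {x} {xs} (l , a) (l′ , a′) p x≢y = go xs l a ((p , ≢-sym x≢y) ∷ l′) a′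
      where
      go : ∀ {x} xs {ys} → Linked Follows (x ∷ xs) → All (ArcOf H) (x ∷ xs) →
           Linked Follows (swap x ∷ ys) → All (ArcOf H) ys → Trail H ((x ∷ xs) ⟲ ys)
      go []        l       (a ∷ as) l′ a′ = l′ , Subgraph.edge-sym H a ∷ a′
      go (x′ ∷ xs) (f ∷ l) (a ∷ as) l′ a′ =
        go xs l as (Follows-swap f ∷ l′) (Subgraph.edge-sym H a ∷ a′)

    vertices-linked : ∀ W → Trail H W → Linked (Edge H) (vertices W)
    vertices-linked []          _                        = []
    vertices-linked (e ∷ [])    (_ , a ∷ [])             = a ∷ [-]
    vertices-linked (e ∷ f ∷ W) ((refl , _) ∷ l , a ∷ as) = a ∷ vertices-linked (f ∷ W) (l , as)

    -- The walk is cut at its return to the tail of `e`. Up to there the heads are distinct, so they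
    -- list the vertices of a cycle.
    closedTrail⇒cycle : ∀ {e W} → Trail H (e ∷ W) → Unique (map proj₂ (e ∷ W)) →
                        proj₁ e ∈ map proj₂ (e ∷ W) → Cycle H
    closedTrail⇒cycle {e} {W} T@(l , a ∷ as) u e∈ with ys , zs , eq ← ∈-∃++ e∈ = record
      { base   = proj₁ e
      ; rest   = ys
      ; long   = long W ys l eq
      ; simple = Unique-++-∷⁻ ys (subst Unique eq u)
      ; edges  = Linked-++⁻ˡ (proj₁ e ∷ ys ++ [ proj₁ e ])
                   (subst (Linked (Edge H) ∘ (proj₁ e ∷_))
                     (trans eq (sym (List.++-assoc ys [ proj₁ e ] zs))) (vertices-linked (e ∷ W) T))
      }
      where
      long : ∀ W ys {zs} → Linked Follows (e ∷ W) →
             map proj₂ (e ∷ W) ≡ ys ++ proj₁ e ∷ zs → 2 ≤ length ys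
      -- An immediate return makes `e` a loop, and a return after two arcs makes the second one
      -- `swap e`.
      long W [] _ eq = contradiction
        (subst (Edge H (proj₁ e)) (List.∷-injectiveˡ eq) a) arc-irrefl
      long (f ∷ W) (y ∷ []) (fol ∷ _) eq = contradiction
        (cong₂ _,_ (sym (proj₁ fol)) (List.∷-injectiveˡ (List.∷-injectiveʳ eq))) (proj₂ fol)
      long W (_ ∷ _ ∷ ys) _ _ = s≤s (s≤s z≤n)

    -- By induction the heads are distinct, being the vertices of the walk without its first arc; a
    -- return to the tail of that arc would then close a cycle.
    vertices-unique : ¬ Cycle H → ∀ W → Trail H W → Unique (vertices W)
    vertices-unique acyclic [] _ = []
    vertices-unique acyclic (e ∷ W) T = All.¬Any⇒All¬ _ (acyclic ∘ closedTrail⇒cycle T heads) ∷ heads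
      where
      heads′ : ∀ W → Trail H (e ∷ W) → Unique (map proj₂ (e ∷ W))
      heads′ []      _                         = [] ∷ []
      heads′ (f ∷ W) ((refl , _) ∷ l , _ ∷ as) = vertices-unique acyclic (f ∷ W) (l , as)
      heads = heads′ W T

    acyclic⇒notClosed : ¬ Cycle H → ∀ {u W} → Trail H W → W ≢ [] → source u W ≢ target u W
    acyclic⇒notClosed acyclic {W = []}    T ne = contradiction refl ne
    acyclic⇒notClosed acyclic {W = e ∷ W} T _ eq = Unique.Unique[x∷xs]⇒x∉xs
      (vertices-unique acyclic (e ∷ W) T) (subst (_∈ _) (sym eq) (target∈heads {u = proj₁ e} e W))

    ⟲≢[] : ∀ xs {y : Arc n} {ys} → xs ⟲ (y ∷ ys) ≢ []
    ⟲≢[] (x ∷ xs) = ⟲≢[] xs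

    -- Going back along one trail and out along the other would be a closed trail.
    acyclic⇒¬diverging : ¬ Cycle H → ∀ {f g U V} → Trail H (f ∷ U) → Trail H (g ∷ V) →
                         proj₁ f ≡ proj₁ g → f ≢ g → target (proj₂ f) U ≢ target (proj₂ g) V
    acyclic⇒¬diverging acyclic {f} {g} {U} T T′ p f≢g eq =
      acyclic⇒notClosed acyclic {u = proj₁ f} (Trail-⟲ T T′ p f≢g) (⟲≢[] (f ∷ U))
        (trans (source-⟲ {u = proj₁ f} (f ∷ U)) (trans eq (sym (target-⟲ {u = proj₁ f} (f ∷ U)))))

    -- First arcs that differ contradict `acyclic⇒¬diverging`, and if only one walk is empty, the
    -- other is closed. Equality of the lengths is part of the conclusion; `¬oneSided` relies on
    -- this.
    acyclic⇒trail-unique : ¬ Cycle H → ∀ {u} U V → Trail H U → Trail H V →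
                           source u U ≡ u → source u V ≡ u → target u U ≡ target u V → U ≡ V
    acyclic⇒trail-unique acyclic [] [] _ _ _ _ _ = refl
    acyclic⇒trail-unique acyclic {u} [] (g ∷ V) _ T′ _ q eq =
      contradiction (trans q eq) (acyclic⇒notClosed acyclic {u = u} T′ λ ())
    acyclic⇒trail-unique acyclic {u} (f ∷ U) [] T _ p _ eq =
      contradiction (trans p (sym eq)) (acyclic⇒notClosed acyclic {u = u} T λ ())
    acyclic⇒trail-unique acyclic (f ∷ U) (g ∷ V) T T′ p q eq with f ≟ᵃ g
    ... | yes refl = cong (f ∷_) (acyclic⇒trail-unique acyclic U V
                       (Trail-++⁻ʳ [ f ] T) (Trail-++⁻ʳ [ f ] T′)
                       (Linked⇒source (linked T)) (Linked⇒source (linked T′)) eq)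
    ... | no  f≢g  = contradiction eq (acyclic⇒¬diverging acyclic T T′ (trans p (sym q)) f≢g)

-- Forests with one additional edge.

On : ∀ {n} → Arc n → Pred (Arc n) _
On ε f = f ≡ ε ⊎ f ≡ swap ε

On? : ∀ {n} (ε : Arc n) → Unary.Decidable (On ε)
On? ε f = (f ≟ᵃ ε) ⊎-dec (f ≟ᵃ swap ε)

On-swap : ∀ {n} {ε f : Arc n} → On ε f → On ε (swap f)
On-swap (inj₁ p) = inj₂ (cong swap p)
On-swap (inj₂ p) = inj₁ (cong swap p)

On-trans : ∀ {n} {ε δ f : Arc n} → On ε δ → On ε f → On δ f
On-trans (inj₁ refl) f        = f
On-trans (inj₂ refl) (inj₁ p) = inj₂ p
On-trans (inj₂ refl) (inj₂ p) = inj₁ p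

deleteEdge : ∀ {n} {G : Graph n} → Subgraph G → Arc n → Subgraph G
deleteEdge H ε = record
  { Vertex      = Vertex H
  ; Edge        = λ u v → Edge H u v × ¬ On ε (u , v)
  ; edge-sym    = λ (e , ¬on) → Subgraph.edge-sym H e , ¬on ∘ On-swap
  ; edge⇒adj    = Subgraph.edge⇒adj H ∘ proj₁
  ; edge⇒vertex = Subgraph.edge⇒vertex H ∘ proj₁
  }

lastOccurrence : ∀ {a p} {A : Set a} {P : Pred A p} → Unary.Decidable P → ∀ {xs} → Any P xs →
                 ∃₂ λ ys x → ∃ λ zs → xs ≡ ys ++ x ∷ zs × P x × All (¬_ ∘ P) zs
lastOccurrence P? {x ∷ xs} i with Any.any? P? xs
... | yes j with ys , y , zs , refl , py , ¬zs ← lastOccurrence P? j = x ∷ ys , y , zs , refl , py , ¬zs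
... | no ¬j with i
...   | here px = [] , x , xs , refl , px , All.¬Any⇒All¬ xs ¬j
...   | there j = contradiction j ¬j

-- The leading `e` ensures that the first differing arcs have a predecessor in common, and hence a
-- common tail.
firstDifference : ∀ {n} {e : Arc n} U V → Linked Follows (e ∷ U) → Linked Follows (e ∷ V) →
  length U ≡ length V → U ≡ V ⊎
  ∃ λ P → ∃₂ λ a A → ∃₂ λ b B → e ∷ U ≡ P ++ a ∷ A × e ∷ V ≡ P ++ b ∷ B ×
    proj₁ a ≡ proj₁ b × a ≢ b × length A ≡ length B
firstDifference []      []      _ _ _  = inj₁ refl
firstDifference {e = e} (f ∷ U) (g ∷ V) ((p , _) ∷ l) ((q , _) ∷ l′) eq with f ≟ᵃ g
... | no f≢g = inj₂ ([ e ] , f , U , g , V , refl , refl , trans (sym p) q , f≢g , ℕ.suc-injective eq)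
... | yes refl with firstDifference U V l l′ (ℕ.suc-injective eq)
...   | inj₁ U≡V = inj₁ (cong (f ∷_) U≡V)
...   | inj₂ (P , a , A , b , B , r , r′ , rest) =
  inj₂ (e ∷ P , a , A , b , B , cong (e ∷_) r , cong (e ∷_) r′ , rest)

module _ {n : ℕ} {G : Graph n} {H : Subgraph G} {ε : Arc n} (acyclic : ¬ Cycle (deleteEdge H ε)) where

  Trail-delete : ∀ {W} → Trail H W → All (¬_ ∘ On ε) W → Trail (deleteEdge H ε) W
  Trail-delete (l , a) ¬on = l , All.zip (a , ¬on)

  -- Between an arc of ε and its reversal the trail would return to the head of the arc inside the forest.
  ¬reversedLater : ∀ {δ} → On ε δ → ∀ Z {Y} → Trail H (δ ∷ Z ++ Y) → All (¬_ ∘ On ε) Z → swap δ ∉ Y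
  ¬reversedLater {δ} onδ Z {g ∷ Y} T ¬on i with g ≟ᵃ swap δ
  ... | yes refl = closed Z T ¬on
    where
    closed : ∀ Z → Trail H (δ ∷ Z ++ swap δ ∷ Y) → ¬ All (¬_ ∘ On ε) Z
    closed []      ((_ , nb) ∷ _ , _)         _   = nb refl
    closed (z ∷ Z) T@((p , _) ∷ _ , _) ¬on =
      acyclic⇒notClosed acyclic {u = proj₂ δ}
        (Trail-delete (Trail-++⁻ˡ (z ∷ Z) (Trail-++⁻ʳ [ δ ] T)) ¬on) (λ ())
        (trans (sym p) (sym (Linked⇒target (z ∷ Z) (linked T))))
  ... | no g≢ with i
  ...   | here eq = g≢ (sym eq)
  ...   | there j with On? ε g
  -- `Z` collects the arcs since the last passage through ε; a further passage in the orientation of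
  -- `δ` resets it to the empty list.
  ...     | no ¬g = ¬reversedLater onδ (Z ++ [ g ])
                      (subst (Trail H ∘ (δ ∷_)) (sym (List.++-assoc Z [ g ] Y)) T)
                      (All.++⁺ ¬on (¬g ∷ [])) j
  ...     | yes ong with On-trans onδ ong
  ...       | inj₂ eq   = g≢ eq
  ...       | inj₁ refl = ¬reversedLater onδ [] (Trail-++⁻ʳ (δ ∷ Z) T) [] j

  -- Whichever orientation comes first, `¬reversedLater` excludes the other after it; both in one
  -- place would make `δ` a loop.
  ¬bothOrientations : ∀ {δ W} → On ε δ → Trail H W → δ ∈ W → swap δ ∉ W
  ¬bothOrientations {δ} onδ T i j with X , Y , refl ← ∈-∃++ i with ∈-++⁻ X j
  ... | inj₂ (there k) = ¬reversedLater onδ [] (Trail-++⁻ʳ X T) [] k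
  ... | inj₂ (here eq) = arc-irrefl {H = H}
    (subst (Edge H (proj₁ δ)) (cong proj₁ eq) (All.head (arcs (Trail-++⁻ʳ X T))))
  ... | inj₁ k with X₁ , X₂ , refl ← ∈-∃++ k = ¬reversedLater (On-swap onδ) []
    (Trail-++⁻ʳ X₁ (subst (Trail H) (List.++-assoc X₁ _ _) T)) [] (∈-++⁺ʳ X₂ (here refl))

  -- After their last passages through ε both trails follow the same path of the forest; as A
  -- avoids ε, that path contains A, whereas for B it is a proper suffix of B.
  ¬oneSided : ∀ {δ u} → On ε δ → ∀ P A B → Trail H (P ++ A) → Trail H (P ++ B) →
              target u (P ++ A) ≡ target u (P ++ B) → length A ≡ length B →
              All (¬_ ∘ On ε) A → δ ∈ P → δ ∉ B
  ¬oneSided {δ} {u} onδ P A B T T′ eq len ¬on i j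
    with X , g , Q , refl , ong , ¬Q ← lastOccurrence (On? ε) (lose i onδ)
    with Y , h , R , refl , onh , ¬R ← lastOccurrence (On? ε) (lose j onδ)
    with On-trans onδ ong
  -- Both last passages, in `P` and in `B`, have the orientation of `δ`, since `P ++ B` contains `δ`
  -- already.
  ... | inj₂ refl = ¬bothOrientations onδ T′ (∈-++⁺ˡ i) (∈-++⁺ˡ (∈-++⁺ʳ X (here refl)))
  ... | inj₁ refl with On-trans onδ onh
  ...   | inj₂ refl = ¬bothOrientations onδ T′ (∈-++⁺ˡ i) (∈-++⁺ʳ P (∈-++⁺ʳ Y (here refl)))
  ...   | inj₁ refl = ℕ.<-irrefl refl (begin-strict
    length A            ≤⟨ List.length-++-≤ʳ A {Q} ⟩
    length (Q ++ A)     ≡⟨ cong length Q++A≡R ⟩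
    length R            <⟨ List.length-++-≤ʳ (δ ∷ R) {Y} ⟩
    length (Y ++ δ ∷ R) ≡⟨ len ⟨
    length A            ∎)
    where
    open ℕ.≤-Reasoning
    TA : Trail H (δ ∷ Q ++ A)
    TA = Trail-++⁻ʳ X (subst (Trail H) (List.++-assoc X _ _) T)
    TB : Trail H (δ ∷ R)
    TB = Trail-++⁻ʳ Y (Trail-++⁻ʳ (X ++ δ ∷ Q) T′)
    Q++A≡R : Q ++ A ≡ R
    Q++A≡R = acyclic⇒trail-unique acyclic {u = proj₂ δ} (Q ++ A) R
      (Trail-delete (Trail-++⁻ʳ [ δ ] TA) (All.++⁺ ¬Q ¬on))
      (Trail-delete (Trail-++⁻ʳ [ δ ] TB) ¬R)
      (Linked⇒source (linked TA)) (Linked⇒source (linked TB))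
      (trans (sym (trans (cong (target u) (List.++-assoc X (δ ∷ Q) A)) (target-++ X)))
        (trans eq (trans (target-++ P) (target-++ Y))))

  inPrefix : ∀ {P A δ} → On ε δ → ¬ Any (On ε) A → δ ∈ P ++ A → δ ∈ P
  inPrefix {P} onδ ¬A i with ∈-++⁻ P i
  ... | inj₁ j = j
  ... | inj₂ j = contradiction (lose j onδ) ¬A

  -- If neither branch meets ε, they diverge inside the forest. If just one does, the inclusions put
  -- its arc of ε into `P`, and `¬oneSided` applies. If both meet ε in the same orientation, going
  -- back along one branch and out along the other passes ε both ways; if in opposite orientations,
  -- the second walk itself contains both.
  ¬diverging : ∀ {u} P {a b A B} → Trail H (P ++ a ∷ A) → Trail H (P ++ b ∷ B) →
               proj₁ a ≡ proj₁ b → a ≢ b → length A ≡ length B →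
               target u (P ++ a ∷ A) ≡ target u (P ++ b ∷ B) →
               (∀ {δ} → On ε δ → δ ∈ P ++ a ∷ A → δ ∈ P ++ b ∷ B) →
               ¬ (∀ {δ} → On ε δ → δ ∈ P ++ b ∷ B → δ ∈ P ++ a ∷ A)
  ¬diverging {u} P {a} {b} {A} {B} T T′ p a≢b len eq ⊆ ⊇
    with Any.any? (On? ε) (a ∷ A) | Any.any? (On? ε) (b ∷ B)
  ... | no ¬i | no ¬j = acyclic⇒¬diverging acyclic
    (Trail-delete (Trail-++⁻ʳ P T) (All.¬Any⇒All¬ _ ¬i))
    (Trail-delete (Trail-++⁻ʳ P T′) (All.¬Any⇒All¬ _ ¬j)) p a≢b
    (trans (sym (target-++ P)) (trans eq (target-++ P)))
  ... | no ¬i | yes j with δ , δ∈ , onδ ← find j =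
    ¬oneSided onδ P _ _ T T′ eq (cong suc len) (All.¬Any⇒All¬ _ ¬i)
      (inPrefix onδ ¬i (⊇ onδ (∈-++⁺ʳ P δ∈))) δ∈
  ... | yes i | no ¬j with δ , δ∈ , onδ ← find i =
    ¬oneSided onδ P _ _ T′ T (sym eq) (cong suc (sym len)) (All.¬Any⇒All¬ _ ¬j)
      (inPrefix onδ ¬j (⊆ onδ (∈-++⁺ʳ P δ∈))) δ∈
  ... | yes i | yes j with δ , δ∈ , onδ ← find i | γ , γ∈ , onγ ← find j with On-trans onδ onγ
  ...   | inj₁ refl = ¬bothOrientations onδ
    (Trail-⟲ (Trail-++⁻ʳ P T) (Trail-++⁻ʳ P T′) p a≢b) (∈-⟲⁺ʳ (a ∷ A) γ∈) (∈-⟲⁺ˡ (a ∷ A) δ∈)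
  ...   | inj₂ refl = ¬bothOrientations onδ T′ (⊆ onδ (∈-++⁺ʳ P δ∈)) (∈-++⁺ʳ P γ∈)

  trail-unique : ∀ {e U V} → Trail H (e ∷ U) → Trail H (e ∷ V) → length U ≡ length V →
                 target (proj₂ e) U ≡ target (proj₂ e) V →
                 (∀ {δ} → On ε δ → δ ∈ e ∷ U → δ ∈ e ∷ V) →
                 (∀ {δ} → On ε δ → δ ∈ e ∷ V → δ ∈ e ∷ U) → U ≡ V
  trail-unique {e} {U} {V} T T′ len eq ⊆ ⊇ with firstDifference U V (linked T) (linked T′) len
  ... | inj₁ U≡V = U≡V
  ... | inj₂ (P , a , A , b , B , r , r′ , p , a≢b , len′) = contradiction
    (λ {δ} → subst₂ (λ W W′ → On ε δ → δ ∈ W → δ ∈ W′) r′ r ⊇)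
    (¬diverging {u = proj₁ e} P (subst (Trail H) r T) (subst (Trail H) r′ T′) p a≢b len′
      (trans (cong (target (proj₁ e)) (sym r)) (trans eq (cong (target (proj₁ e)) r′)))
      (λ {δ} → subst₂ (λ W W′ → On ε δ → δ ∈ W → δ ∈ W′) r r′ ⊆))

-- Counting by fibres.

length-filter-split : ∀ {A : Set} {P : Pred A 0ℓ} (P? : Unary.Decidable P) xs →
  length xs ≡ length (filter P? xs) + length (filter (¬? ∘ P?) xs)
length-filter-split P? [] = refl
length-filter-split P? (x ∷ xs) with P? x
... | yes _ = cong suc (length-filter-split P? xs)
... | no  _ = trans (cong suc (length-filter-split P? xs)) (sym (ℕ.+-suc _ _))

-- A cardinality bound stated through duplicate-free lists, so that it makes sense without an
-- enumeration of `P`.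
AtMost : ∀ {A : Set} → ℕ → Pred A 0ℓ → Set
AtMost k P = ∀ xs → Unique xs → All P xs → length xs ≤ k

AtMost-⊆ : ∀ {A : Set} {k} {P Q : Pred A 0ℓ} → (∀ {x} → P x → Q x) → AtMost k Q → AtMost k P
AtMost-⊆ P⊆Q most xs u ps = most xs u (All.map P⊆Q ps)

AtMost-1 : ∀ {A : Set} {P : Pred A 0ℓ} → (∀ {x y} → P x → P y → x ≡ y) → AtMost 1 P
AtMost-1 eq []           _               _            = z≤n
AtMost-1 eq (x ∷ [])     _               _            = s≤s z≤n
AtMost-1 eq (x ∷ y ∷ xs) ((x≢y ∷ _) ∷ _) (p ∷ q ∷ _) = contradiction (eq p q) x≢y

module _ {A B : Set} (_≟_ : DecidableEquality B) (f : A → B) where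

  -- Induction on `ys`: the fibre over `y` is split off, and what remains is covered by the other
  -- values.
  AtMost-fibres : ∀ {m} {P : Pred A 0ℓ} ys → (∀ {x} → P x → f x ∈ ys) →
                  (∀ y → AtMost m (λ x → P x × f x ≡ y)) → AtMost (length ys * m) P
  AtMost-fibres []       cover fibre []       _ _       = z≤n
  AtMost-fibres []       cover fibre (x ∷ xs) _ (p ∷ _) = case cover p of λ ()
  AtMost-fibres {m} {P} (y ∷ ys) cover fibre xs u ps = begin
    length xs                                                ≡⟨ length-filter-split y? xs ⟩
    length (filter y? xs) + length (filter (¬? ∘ y?) xs)
      ≤⟨ ℕ.+-mono-≤
           (fibre y _ (Unique.filter⁺ y? u) (All.zip (All.filter⁺ y? ps , All.all-filter y? xs)))
           (AtMost-fibres ys cover′ (λ z → AtMost-⊆ (λ ((p , _) , q) → p , q) (fibre z)) _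
             (Unique.filter⁺ (¬? ∘ y?) u)
             (All.zip (All.filter⁺ (¬? ∘ y?) ps , All.all-filter (¬? ∘ y?) xs))) ⟩
    m + length ys * m                                        ∎
    where
    open ℕ.≤-Reasoning
    y? : Unary.Decidable (λ x → f x ≡ y)
    y? x = f x ≟ y
    cover′ : ∀ {x} → P x × f x ≢ y → f x ∈ ys
    cover′ (p , ne) with cover p
    ... | here eq = contradiction eq ne
    ... | there i = i

  -- The values to sum over are taken from the given list itself: its deduplicated image has at most
  -- `k` entries.
  AtMost-fibration : ∀ {k m} {P : Pred A 0ℓ} {Q : Pred B 0ℓ} → (∀ {x} → P x → Q (f x)) →
                     AtMost k Q → (∀ y → AtMost m (λ x → P x × f x ≡ y)) → AtMost (k * m) P
  AtMost-fibration {k} {m} {P} {Q} g most fibre xs u ps = begin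
    length xs                   ≤⟨ AtMost-fibres image cover
                                     (λ y → AtMost-⊆ (λ ((_ , p) , q) → p , q) (fibre y))
                                     xs u (All.zip (All.tabulate id , ps)) ⟩
    length image * m            ≤⟨ ℕ.*-monoˡ-≤ m (most image (DecUnique.deduplicate-! _≟_ _)
                                     (All.deduplicate⁺ _≟_ (All.map⁺ (All.map g ps)))) ⟩
    k * m                       ∎
    where
    open ℕ.≤-Reasoning
    image = deduplicate _≟_ (map f xs)
    cover : ∀ {x} → x ∈ xs × P x → f x ∈ image
    cover (i , _) = ∈-deduplicate⁺ _≟_ (∈-map⁺ f i)

  AtMost-injective : ∀ {k} {P : Pred A 0ℓ} {Q : Pred B 0ℓ} → (∀ {x} → P x → Q (f x)) →
                     (∀ {x y} → P x → P y → f x ≡ f y → x ≡ y) → AtMost k Q → AtMost k P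
  AtMost-injective {k} {P} g inj most = subst (λ k → AtMost k P) (ℕ.*-identityʳ k)
    (AtMost-fibration g most λ y → AtMost-1 λ (p , eq) (q , eq′) → inj p q (trans eq (sym eq′)))

AtMost-∈ : ∀ {A : Set} → DecidableEquality A → (ys : List A) → AtMost (length ys) (_∈ ys)
AtMost-∈ _≟_ ys = subst (λ k → AtMost k (_∈ ys)) (ℕ.*-identityʳ _)
  (AtMost-fibres _≟_ id ys id λ y → AtMost-1 λ (_ , p) (_ , q) → trans p (sym q))

-- Enumerated vectors and the arcs of a subgraph.

allVecs-unique : ∀ {A : Set} {xs : List A} → Unique xs → ∀ m → Unique (allVecs xs m)
allVecs-unique u zero    = [] ∷ []
allVecs-unique u (suc m) =
  Unique.cartesianProductWith⁺ Vec._∷_ (λ eq → Vec.∷-injective eq) u (allVecs-unique u m)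

-- Each arc is sent to its orientation with the smaller tail, the one that `edgeCount` lists; only
-- an arc and its reversal share an image.
AtMost-ArcOf : ∀ {n} {G : Graph n} (S : Subgraph G) (edge? : Decidable (Edge S)) →
               AtMost (2 * edgeCount S edge?) (ArcOf S)
AtMost-ArcOf {n} {G} S edge? = subst (λ k → AtMost k (ArcOf S)) (ℕ.*-comm (length edges) 2)
  (AtMost-fibres _≟ᵃ_ ordered edges ordered∈ λ e → AtMost-⊆ ordered-fibre (AtMost-∈ _≟ᵃ_ (e ∷ swap e ∷ [])))
  where
  edge<? : Unary.Decidable (λ ((u , v) : Arc n) → u Fin.< v × Edge S u v)
  edge<? (u , v) = (u Fin.<? v) ×-dec edge? u v
  edges = filter edge<? (allArcs n)

  ordered : Arc n → Arc n
  ordered (u , v) with u Fin.<? v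
  ... | yes _ = u , v
  ... | no  _ = v , u

  ∈-edges : ∀ {u v} → u Fin.< v → Edge S u v → (u , v) ∈ edges
  ∈-edges u<v e = ∈-filter⁺ edge<? (∈-cartesianProduct⁺ (∈-allFin _) (∈-allFin _)) (u<v , e)

  ordered∈ : ∀ {e} → ArcOf S e → ordered e ∈ edges
  ordered∈ {u , v} e with u Fin.<? v
  ... | yes u<v = ∈-edges u<v e
  ... | no  u≮v = ∈-edges (Fin.≤∧≢⇒< (ℕ.≮⇒≥ u≮v) λ {refl → arc-irrefl {H = S} e}) (Subgraph.edge-sym S e)

  ordered-fibre : ∀ {e f} → ArcOf S f × ordered f ≡ e → f ∈ e ∷ swap e ∷ []
  ordered-fibre {f = u , v} (_ , eq) with u Fin.<? v
  ... | yes _ = here eq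
  ... | no  _ = there (here (cong swap eq))

-- Distances, balls and their cycles.

module _ {n : ℕ} {G : Graph n} where

  walk? : ∀ ℓ u v → Dec (Walk G ℓ u v)
  walk? zero    u v = map′ (λ {refl → nil}) (λ {nil → refl}) (u Fin.≟ v)
  walk? (suc ℓ) u v = map′ (λ (_ , a , w) → cons a w) (λ {(cons a w) → _ , a , w})
    (Fin.any? λ x → Graph.adj? G u x ×-dec walk? ℓ x v)

  snoc : ∀ {ℓ u v w} → Walk G ℓ u v → Adj G v w → Walk G (suc ℓ) u w
  snoc nil        b = cons b nil
  snoc (cons a p) b = cons a (snoc p b)

  -- Strong induction on the length: as walks of given length are decidable, either a shorter one
  -- exists or the given one realises the distance.
  walk⇒distance : ∀ {u v} ℓ → Walk G ℓ u v → ∃ λ d → Distance G u v d × d ≤ ℓ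
  walk⇒distance {u} {v} = <-rec (λ ℓ → Walk G ℓ u v → ∃ λ d → Distance G u v d × d ≤ ℓ) λ ℓ rec p →
    case ℕ.anyUpTo? (λ k → walk? k u v) ℓ of λ where
      (yes (k , k<ℓ , q)) → let d , D , d≤k = rec k<ℓ q in d , D , ℕ.≤-trans d≤k (ℕ.<⇒≤ k<ℓ)
      (no shortest)       → ℓ , (p , λ k q → ℕ.≮⇒≥ λ k<ℓ → shortest (k , k<ℓ , q)) , ℕ.≤-refl

  walk⇒ball : ∀ {R u v} ℓ → Walk G ℓ u v → ℓ ≤ R → Vertex (ball G R u) v
  walk⇒ball ℓ p ℓ≤R = let d , D , d≤ℓ = walk⇒distance ℓ p in d , D , ℕ.≤-trans d≤ℓ ℓ≤R

  -- The ball is centred at the head of `e`, and each further arc moves at most one step away. The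
  -- tail of `e` lies at distance one, whence `1 ≤ R`.
  trail⊆ball : ∀ {S : Subgraph G} {R e U} → 1 ≤ R → Trail S (e ∷ U) → length U ≤ R →
               Trail (ball G R (proj₂ e)) (e ∷ U)
  trail⊆ball {S} {R} {e} {U} 1≤R T@(l , a ∷ _) len = l ,
    (adj₀ , walk⇒ball 1 (cons (Graph.sym G adj₀) nil) 1≤R , walk⇒ball 0 nil z≤n) ∷ later nil T len
    where
    adj₀ = Subgraph.edge⇒adj S a
    later : ∀ {ℓ f V} → Walk G ℓ (proj₂ e) (proj₂ f) → Trail S (f ∷ V) → ℓ + length V ≤ R →
            All (ArcOf (ball G R (proj₂ e))) V
    later {V = []} _ _ _ = []
    later {ℓ} {V = g ∷ V} p ((refl , _) ∷ l , _ ∷ as@(a ∷ _)) len =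
      (adj , walk⇒ball ℓ p (ℕ.m+n≤o⇒m≤o ℓ len) , walk⇒ball (suc ℓ) p′ (ℕ.m+n≤o⇒m≤o (suc ℓ) len′)) ∷
      later p′ (l , as) len′
      where
      adj = Subgraph.edge⇒adj S a
      p′  = snoc p adj
      len′ : suc ℓ + length V ≤ R
      len′ = subst (_≤ R) (ℕ.+-suc ℓ _) len

  cycle-undelete : ∀ {H : Subgraph G} {ε} → Cycle (deleteEdge H ε) → Cycle H
  cycle-undelete d = record
    { base   = Cycle.base d
    ; rest   = Cycle.rest d
    ; long   = Cycle.long d
    ; simple = Cycle.simple d
    ; edges  = Linked.map proj₁ (Cycle.edges d)
    }

  -- The first edge of the cycle is deleted. A cycle that survived would be a cycle of `H`, so by
  -- uniqueness it would traverse the deleted edge.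
  deleteCycleEdge : ∀ {H : Subgraph G} → AtMostOneCycle H → Cycle H → ∃ λ ε → ¬ Cycle (deleteEdge H ε)
  deleteCycleEdge {H} unique c@record { base = x ; rest = y ∷ ys } = (x , y) , λ d →
    case Equivalence.to (unique c (cycle-undelete d) x y) (inj₁ ([] , _ , refl)) of λ where
      (inj₁ (xs , zs , eq)) → avoids d xs eq (inj₁ refl)
      (inj₂ (xs , zs , eq)) → avoids d xs eq (inj₂ refl)
    where
    avoids : ∀ (d : Cycle (deleteEdge H (x , y))) xs {u v zs} → Cycle.closedWalk d ≡ xs ++ u ∷ v ∷ zs →
             ¬ On (x , y) (u , v)
    avoids d xs eq = proj₂ (Linked.head (Linked-++⁻ʳ xs (subst (Linked _) eq (Cycle.edges d))))
  deleteCycleEdge _ record { rest = [] ; long = () }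

-- Counting paths in blocks of R steps.

module _ {n : ℕ} where

  lastArc : Arc n → List (Arc n) → Arc n
  lastArc e []      = e
  lastArc e (f ∷ W) = lastArc f W

  target-lastArc : ∀ e W → target (proj₂ e) W ≡ proj₂ (lastArc e W)
  target-lastArc e []      = refl
  target-lastArc e (f ∷ W) = target-lastArc f W

  Trail-lastArc : ∀ {G : Graph n} {S : Subgraph G} {e} xs {ys} →
                  Trail S (e ∷ xs ++ ys) → Trail S (lastArc e xs ∷ ys)
  Trail-lastArc []       T = T
  Trail-lastArc {e = e} (x ∷ xs) T = Trail-lastArc xs (Trail-++⁻ʳ [ e ] T)

  ArcOf-lastArc : ∀ {G : Graph n} {S : Subgraph G} {e} xs → Trail S (e ∷ xs) → ArcOf S (lastArc e xs)
  ArcOf-lastArc [] (_ , a ∷ _) = a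
  ArcOf-lastArc {e = e} (x ∷ xs) T = ArcOf-lastArc xs (Trail-++⁻ʳ [ e ] T)

module _ {n : ℕ} {G : Graph n} (S : Subgraph G) where

  -- The initial arc is left out, so that the last arc of one block can be the initial arc of the
  -- next.
  Continuation : Arc n → ℕ → Pred (List (Arc n)) _
  Continuation e t U = Trail S (e ∷ U) × length U ≡ t

  module _ (edge? : Decidable (Edge S)) where

    open DecMembership (_≟ᵃ_ {n}) using (_∈?_)

    block : ∀ {R} → 1 ≤ R → (∀ v → AtMostOneCycle (ball G R v)) → ∀ {e r} → r ≤ R →
            AtMost (2 * edgeCount S edge? * (R + 3)) (Continuation e r)
    -- The claimed inequality is decidable, hence stable, so excluded middle may be used for the
    -- existence of a cycle.
    block {R} 1≤R unicyclic {e} {r} r≤R xs u ps = decidable-stable (_ ℕ.≤? _) λ ¬bound →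
      ¬¬-excluded-middle {A = Cycle (ball G R (proj₂ e))} λ where
        (yes c) → let ε , acyclic = deleteCycleEdge (unicyclic _) c in ¬bound (bound acyclic xs u ps)
        -- In a forest any edge may play the part of ε; `e` is taken.
        (no ¬c) → ¬bound (bound {e} (¬c ∘ cycle-undelete) xs u ps)
      where
      bools = true ∷ false ∷ []
      ∈-bools : ∀ b → b ∈ bools
      ∈-bools true  = here refl
      ∈-bools false = there (here refl)

      bound : ∀ {ε} → ¬ Cycle (deleteEdge (ball G R (proj₂ e)) ε) →
              AtMost (2 * edgeCount S edge? * (R + 3)) (Continuation e r)
      bound {ε} acyclic = AtMost-fibration _≟ᵃ_ (lastArc e) (λ {U} (T , _) → ArcOf-lastArc U T)
        -- The last arc has 2s possible values; over each there are at most four codes, and 4 = 1 +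
        -- 3 ≤ R + 3.
        (AtMost-ArcOf S edge?) λ f → AtMost-mono (ℕ.+-monoˡ-≤ 3 1≤R) (fibre f)
        where
        AtMost-mono : ∀ {A : Set} {k l} {P : Pred A 0ℓ} → k ≤ l → AtMost k P → AtMost l P
        AtMost-mono k≤l most xs u ps = ℕ.≤-trans (most xs u ps) k≤l

        code : List (Arc n) → Bool × Bool
        code U = does (ε ∈? (e ∷ U)) , does (swap ε ∈? (e ∷ U))

        decode : ∀ {A B : Set} (a? : Dec A) (b? : Dec B) → does a? ≡ does b? → A → B
        decode (yes _) (yes b) _ _ = b
        decode (no ¬a) _       _ a = contradiction a ¬a
        decode (yes _) (no _) ()

        decodeOn : ∀ {U V} → code U ≡ code V → ∀ {δ} → On ε δ → δ ∈ e ∷ U → δ ∈ e ∷ V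
        decodeOn eq (inj₁ refl) = decode (_ ∈? _) (_ ∈? _) (cong proj₁ eq)
        decodeOn eq (inj₂ refl) = decode (_ ∈? _) (_ ∈? _) (cong proj₂ eq)

        fibre : ∀ f → AtMost 4 (λ U → Continuation e r U × lastArc e U ≡ f)
        fibre f = AtMost-injective (Product.≡-dec Bool._≟_ Bool._≟_) code
          {Q = _∈ cartesianProduct bools bools}
          (λ _ → ∈-cartesianProduct⁺ (∈-bools _) (∈-bools _))
          (λ {U} {V} ((T , len) , p) ((T′ , len′) , q) eq → trail-unique acyclic
            (trail⊆ball 1≤R T (subst (_≤ R) (sym len) r≤R))
            (trail⊆ball 1≤R T′ (subst (_≤ R) (sym len′) r≤R))
            (trans len (sym len′))
            (trans (target-lastArc e U) (trans (cong proj₂ (trans p (sym q))) (sym (target-lastArc e V))))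
            (decodeOn eq) (decodeOn (sym eq)))
          (AtMost-∈ (Product.≡-dec Bool._≟_ Bool._≟_) _)

    -- Dropping the first arc of a path is injective, because that arc is always `e`.
    pathCount≤ : ∀ {e t k} → AtMost k (Continuation e t) → pathCount S edge? e t ≤ k
    pathCount≤ {e} {t} most = AtMost-injective (List.≡-dec _≟ᵃ_) (λ es → Vec.toList (Vec.tail es))
      continuation injective most _
      (Unique.filter⁺ path? (allVecs-unique
        (Unique.cartesianProduct⁺ (Unique.allFin⁺ n) (Unique.allFin⁺ n)) (suc t)))
      (All.all-filter path? (allVecs (allArcs n) (suc t)))
      where
      path? = isNonBacktrackingPath? S edge? e

      toList-linked : ∀ {m} {es : Vec (Arc n) m} → VecLinked.Linked Follows es → Linked Follows (Vec.toList es)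
      toList-linked VecLinked.[] = []
      toList-linked VecLinked.[-] = [-]
      toList-linked {es = _ ∷ _ ∷ _} (r VecLinked.∷ rs) = r ∷ toList-linked rs

      continuation : ∀ {es : Vec (Arc n) (suc t)} → IsNonBacktrackingPath S e es →
                     Continuation e t (Vec.toList (Vec.tail es))
      continuation {_ ∷ es} (refl , a , l) = (toList-linked l , VecAll.toList⁺ a) , Vec.length-toList es

      injective : ∀ {es fs : Vec (Arc n) (suc t)} → IsNonBacktrackingPath S e es → IsNonBacktrackingPath S e fs →
                  Vec.toList (Vec.tail es) ≡ Vec.toList (Vec.tail fs) → es ≡ fs
      injective {_ ∷ es} {_ ∷ fs} (refl , _) (refl , _) eq =
        cong (e ∷_) (trans (sym (Vec.cast-is-id refl es)) (Vec.toList-injective refl es fs eq))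

  -- The first `R` arcs form a block with at most `M` choices; the rest continues from its last arc
  -- and is counted by induction. The block has `R ⊓ t` arcs, so the bound is required for all
  -- lengths up to `R`.
  blocks : ∀ {M R} → (∀ {e r} → r ≤ R → AtMost M (Continuation e r)) →
           ∀ k {e t} → t ≤ k * R → AtMost (M ^ k) (Continuation e t)
  blocks bound zero z≤n = AtMost-1 λ (_ , p) (_ , q) → empty p q
    where
    empty : ∀ {U V : List (Arc n)} → length U ≡ 0 → length V ≡ 0 → U ≡ V
    empty {[]} {[]} _ _ = refl
  blocks {M} {R} bound (suc k) {e} {t} t≤ = AtMost-fibration (List.≡-dec _≟ᵃ_) (take R)
    (λ {U} (T , len) →
      Trail-++⁻ˡ (e ∷ take R U) (subst (Trail S ∘ (e ∷_)) (sym (List.take++drop≡id R U)) T) ,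
      trans (List.length-take R U) (cong (R ⊓_) len))
    (bound (ℕ.m⊓n≤m R t))
    λ W → AtMost-injective (List.≡-dec _≟ᵃ_) (drop R)
      (λ {U} ((T , len) , p) →
        subst (λ W → Trail S (lastArc e W ∷ drop R U)) p
          (Trail-lastArc (take R U) (subst (Trail S ∘ (e ∷_)) (sym (List.take++drop≡id R U)) T)) ,
        trans (List.length-drop R U) (cong (_∸ R) len))
      (λ {U} {V} (_ , p) (_ , q) eq → trans (sym (List.take++drop≡id R U))
        (trans (cong₂ _++_ (trans p (sym q)) eq) (List.take++drop≡id R V)))
      (blocks bound k (ℕ.≤-trans (ℕ.∸-monoˡ-≤ R t≤) (ℕ.≤-reflexive (ℕ.m+n∸m≡n R (k * R)))))

-- Arithmetic of the bounds.

≤⌈/⌉* : ∀ t R .{{_ : NonZero R}} → t ≤ ⌈ t / R ⌉ * R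
≤⌈/⌉* t (suc r) = ℕ.+-cancelʳ-≤ r t _ (begin
  t + r                                          ≡⟨ m≡m%n+[m/n]*n (t + r) (suc r) ⟩
  (t + r) % suc r + ⌈ t / suc r ⌉ * suc r        ≤⟨ ℕ.+-monoˡ-≤ _ (ℕ.≤-pred (m%n<n (t + r) (suc r))) ⟩
  r + ⌈ t / suc r ⌉ * suc r                      ≡⟨ ℕ.+-comm r _ ⟩
  ⌈ t / suc r ⌉ * suc r + r                      ∎)
  where open ℕ.≤-Reasoning

^-*-mono-≤ : ∀ {a b c} k → a * b ≤ c → a ^ k * b ^ k ≤ c ^ k
^-*-mono-≤ zero    _  = ℕ.≤-refl
^-*-mono-≤ {a} {b} {c} (suc k) ab≤c = begin
  (a * a ^ k) * (b * b ^ k)   ≡⟨ ℕ.[m*n]*[o*p]≡[m*o]*[n*p] a (a ^ k) b (b ^ k) ⟩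
  (a * b) * (a ^ k * b ^ k)   ≤⟨ ℕ.*-mono-≤ ab≤c (^-*-mono-≤ k ab≤c) ⟩
  c * c ^ k                   ∎
  where open ℕ.≤-Reasoning

^-cancelʳ-< : ∀ {m n} k → m ^ k < n ^ k → m < n
^-cancelʳ-< k lt = ℕ.≰⇒> λ n≤m → ℕ.<⇒≱ lt (ℕ.^-monoˡ-≤ k n≤m)

-- A factor m per block of R steps suffices to absorb the rounding of t / R, once there are four blocks.
fromBlocks : ∀ {m M R p q t N} .{{_ : NonZero R}} → 2 ≤ m → M ≤ m ^ 4 → m ^ 5 * q ^ R < p ^ R →
             4 * R ≤ t → N ≤ M ^ suc (t / R) → N * q ^ t ≤ p ^ t
fromBlocks {m} {M} {R} {p} {q} {t} {N} 2≤m M≤ lt 4R≤t N≤ = begin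
  N * q ^ t                               ≤⟨ ℕ.*-monoˡ-≤ (q ^ t) N≤m ⟩
  (m ^ 5) ^ k * q ^ t                     ≡⟨ cong ((m ^ 5) ^ k *_) (split q) ⟩
  (m ^ 5) ^ k * ((q ^ R) ^ k * q ^ j)     ≡⟨ ℕ.*-assoc ((m ^ 5) ^ k) _ _ ⟨
  -- The complete blocks use the hypothesis `k` times; the `t % R` leftover steps only use `q ≤ p`.
  (m ^ 5) ^ k * (q ^ R) ^ k * q ^ j       ≤⟨ ℕ.*-mono-≤ (^-*-mono-≤ k (ℕ.<⇒≤ lt)) (ℕ.^-monoˡ-≤ j q≤p) ⟩
  (p ^ R) ^ k * p ^ j                     ≡⟨ split p ⟨
  p ^ t                                   ∎
  where
  open ℕ.≤-Reasoning
  k = t / R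
  j = t % R
  instance
    m≢0 : NonZero m
    m≢0 = >-nonZero (ℕ.<⇒≤ 2≤m)
    m⁵≢0 : NonZero (m ^ 5)
    m⁵≢0 = ℕ.m^n≢0 m 5
  split : ∀ x → x ^ t ≡ (x ^ R) ^ k * x ^ j
  split x = begin-equality
    x ^ t                 ≡⟨ cong (x ^_) (trans (m≡m%n+[m/n]*n t R) (ℕ.+-comm j _)) ⟩
    x ^ (k * R + j)       ≡⟨ ℕ.^-distribˡ-+-* x (k * R) j ⟩
    x ^ (k * R) * x ^ j   ≡⟨ cong (λ i → x ^ i * x ^ j) (ℕ.*-comm k R) ⟩
    x ^ (R * k) * x ^ j   ≡⟨ cong (_* x ^ j) (ℕ.^-*-assoc x R k) ⟨
    (x ^ R) ^ k * x ^ j   ∎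
  q≤p : q ≤ p
  q≤p = ℕ.<⇒≤ (^-cancelʳ-< R (ℕ.≤-<-trans (ℕ.m≤n*m (q ^ R) (m ^ 5)) lt))
  4≤k : 4 ≤ k
  4≤k = subst (_≤ k) (m*n/n≡m 4 R) (/-monoˡ-≤ R 4R≤t)
  N≤m : N ≤ (m ^ 5) ^ k
  N≤m = begin
    N                 ≤⟨ N≤ ⟩
    M ^ suc k         ≤⟨ ℕ.^-monoˡ-≤ (suc k) M≤ ⟩
    (m ^ 4) ^ suc k   ≡⟨ ℕ.^-*-assoc m 4 (suc k) ⟩
    m ^ (4 * suc k)   ≤⟨ ℕ.^-monoʳ-≤ m
                           (ℕ.≤-trans (ℕ.≤-reflexive (ℕ.*-suc 4 k)) (ℕ.+-monoˡ-≤ (4 * k) 4≤k)) ⟩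
    m ^ (5 * k)       ≡⟨ ℕ.^-*-assoc m 5 k ⟨
    (m ^ 5) ^ k       ∎

-- From R + 3 ≤ 4R the left side is at most 8sR, and 8 is at most the cube of sR.
blockBound≤ : ∀ s {R} → 1 ≤ R → 2 ≤ s * R → 2 * s * (R + 3) ≤ (s * R) ^ 4
blockBound≤ s {R} 1≤R 2≤m = begin
  2 * s * (R + 3)         ≤⟨ ℕ.*-monoʳ-≤ (2 * s) (ℕ.+-monoʳ-≤ R (ℕ.*-monoʳ-≤ 3 1≤R)) ⟩
  2 * s * (4 * R)         ≡⟨ ℕ.[m*n]*[o*p]≡[m*o]*[n*p] 2 s 4 R ⟩
  8 * (s * R)             ≤⟨ ℕ.*-monoˡ-≤ (s * R) (ℕ.^-monoˡ-≤ 3 2≤m) ⟩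
  (s * R) ^ 3 * (s * R)   ≡⟨ ℕ.*-comm ((s * R) ^ 3) (s * R) ⟩
  (s * R) ^ 4             ∎
  where open ℕ.≤-Reasoning

-- The single edge and the conclusion.

module _ {n : ℕ} {G : Graph n} (S : Subgraph G) (edge? : Decidable (Edge S)) where

  edgeCount>0 : ∀ {e} → ArcOf S e → 1 ≤ edgeCount S edge?
  edgeCount>0 {e} a with edgeCount S edge? | AtMost-ArcOf S edge? [ e ] ([] ∷ []) (a ∷ [])
  ... | suc _ | _ = s≤s z≤n

  -- A next arc `f` would make `e`, `swap e` and `f` three distinct arcs of `S`, which has at most
  -- two.
  singleEdge : edgeCount S edge? ≡ 1 → ∀ {e t} → 1 ≤ t → AtMost 0 (Continuation S e t)
  singleEdge s≡1 1≤t [] _ _ = z≤n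
  singleEdge s≡1 () ([] ∷ _) _ ((_ , refl) ∷ _)
  singleEdge s≡1 {e} 1≤t ((f ∷ _) ∷ _) _ ((((p , nb) ∷ _ , a ∷ b ∷ _) , _) ∷ _) = contradiction
    (subst (λ s → 3 ≤ 2 * s) s≡1
      (AtMost-ArcOf S edge? (e ∷ swap e ∷ f ∷ [])
        ((loop ∘ cong proj₁ ∷ (λ e≡f → loop (trans (cong proj₁ e≡f) (sym p))) ∷ []) ∷ (≢-sym nb ∷ []) ∷ [] ∷ [])
        (a ∷ Subgraph.edge-sym S a ∷ b ∷ [])))
    λ where (s≤s (s≤s ()))
    where
    loop : proj₁ e ≢ proj₂ e
    loop eq = arc-irrefl {H = S} (subst (Edge S (proj₁ e)) (sym eq) a)

lemma19 : (∀ n (G : Graph n) (R : ℕ) → .{{_ : NonZero R}} →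
    (∀ v → AtMostOneCycle (ball G R v)) →
    (S : Subgraph G) (edge? : Decidable (Edge S)) →
    ∀ e₀ → ArcOf S e₀ → ∀ t → 1 ≤ t →
    pathCount S edge? e₀ t ≤ (2 * edgeCount S edge? * (R + 3)) ^ ⌈ t / R ⌉)
    ×
    (∃ λ C →
    ∀ n (G : Graph n) (R : ℕ) → .{{_ : NonZero R}} →
    (∀ v → AtMostOneCycle (ball G R v)) →
    (S : Subgraph G) (edge? : Decidable (Edge S)) →
    ∀ e₀ → ArcOf S e₀ →
    GrowthRate≤exp[ C ·log (edgeCount S edge? * R) / R ] (pathCount S edge? e₀))
lemma19 =
  (λ n G R unicyclic S edge? e₀ _ t _ → byBlocks G R unicyclic S edge? ⌈ t / R ⌉ (≤⌈/⌉* t R)) ,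
  -- Four factors sR come from `blockBound≤`, the fifth from rounding the number of blocks.
  5 , growth
  where
  byBlocks : ∀ {n} (G : Graph n) R → .{{_ : NonZero R}} → (∀ v → AtMostOneCycle (ball G R v)) →
             (S : Subgraph G) (edge? : Decidable (Edge S)) → ∀ k {e t} → t ≤ k * R →
             pathCount S edge? e t ≤ (2 * edgeCount S edge? * (R + 3)) ^ k
  byBlocks G R unicyclic S edge? k t≤ =
    pathCount≤ S edge? (blocks S (block S edge? (>-nonZero⁻¹ R) unicyclic) k t≤)

  growth : ∀ n (G : Graph n) R → .{{_ : NonZero R}} → (∀ v → AtMostOneCycle (ball G R v)) →
           (S : Subgraph G) (edge? : Decidable (Edge S)) → ∀ e₀ → ArcOf S e₀ →
           GrowthRate≤exp[ 5 ·log (edgeCount S edge? * R) / R ] (pathCount S edge? e₀)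
  growth n G R unicyclic S edge? e₀ a p q lt with edgeCount S edge? * R in m≡
  -- Here sR = 1 forces s = 1, so no path of positive length exists and the threshold is 1.
  ... | suc zero = 1 , λ t 1≤t → subst (λ N → N * q ^ t ≤ p ^ t)
    (sym (ℕ.n≤0⇒n≡0 (pathCount≤ S edge? (singleEdge S edge? (ℕ.m*n≡1⇒m≡1 _ R m≡) 1≤t)))) z≤n
  ... | zero = contradiction (subst (1 ≤_) m≡ (ℕ.*-mono-≤ (edgeCount>0 S edge? a) (>-nonZero⁻¹ R))) λ ()
  ... | m@(suc (suc _)) = 4 * R , λ t 4R≤t → fromBlocks {m = m} {q = q} 2≤m
    (subst (λ m → 2 * edgeCount S edge? * (R + 3) ≤ m ^ 4) m≡
      (blockBound≤ (edgeCount S edge?) (>-nonZero⁻¹ R) (subst (2 ≤_) (sym m≡) 2≤m)))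
    -- The quotient plus one blocks suffice, since the remainder is at most `R`.
    lt 4R≤t (byBlocks G R unicyclic S edge? (suc (t / R))
      (ℕ.≤-trans (ℕ.≤-reflexive (m≡m%n+[m/n]*n t R)) (ℕ.+-monoˡ-≤ _ (m%n≤n t R))))
    where
    2≤m : 2 ≤ m
    2≤m = s≤s (s≤s z≤n)
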